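{- The symbolic algorithm SCC-Find (the algorithm of Gentilini et al., described in the context), started on a directed graph $G$ with the empty skeleton, computes the strongly connected components (SCCs) of $G$ with $O\big(|SCCs(G)|+\sum_{C\in SCCs(G)}D_C\big)$ symbolic operations, where $SCCs(G)$ is the set of SCCs of $G$ and $D_C$ is the diameter of the SCC $C$.
   Context: Symbolic operations on a finite directed graph $G=(V,E)$: the one-step operations $\mathrm{Pre}(S)=\{v\in V\mid \exists s\in S:(v,s)\in E\}$ and $\mathrm{Post}(S)=\{v\in V\mid \exists s\in S:(s,v)\in E\}$ for $S\subseteq V$, and basic set operations ($\cup,\cap,\setminus,\subseteq,=$, emptiness tests) on vertex sets. Symbolic operations on an induced subgraph $G_U$, $U\subseteq V$, are obtained by intersecting the results of $\mathrm{Pre}$, $\mathrm{Post}$ in $G$ with $U$. $\mathrm{Pick}(S)$ returns an arbitrary element of a nonempty set $S$ (constant cost). For an SCC $C$, $D_C$ is the maximum of $d(u,v)$ over $u,v\in C$, where $d(u,v)$ is the smallest number of edges on a path from $u$ to $v$. Procedure Skel-Forward$(V,E,v)$: set $FW\leftarrow\emptyset$, $i\leftarrow 0$, $L[0]\leftarrow\{v\}$. While $L[i]\ne\emptyset$: $FW\leftarrow FW\cup L[i]$; $i\leftarrow i+1$; $L[i]\leftarrow \mathrm{Post}(L[i-1])\setminus FW$. Then $i\leftarrow i-1$; $v'\leftarrow\mathrm{Pick}(L[i])$; $\mathcal S'\leftarrow\{v'\}$. While $i\ge1$: $i\leftarrow i-1$; $\mathcal S'\leftarrow\mathcal S'\cup\{\mathrm{Pick}(\mathrm{Pre}(\mathcal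 S')\cap L[i])\}$. Return $(FW,\mathcal S',v')$. Procedure SCC-Find$(G=(V,E),(\mathcal S,v))$, where $\mathcal S\subseteq V$ and $v$ is a vertex of $\mathcal{S}$ (irrelevant if $\mathcal S=\emptyset$): 1. If $V=\emptyset$, return. If $\mathcal S=\emptyset$, set $v\leftarrow\mathrm{Pick}(V)$. 2. $(FW,\mathcal S',v')\leftarrow$ Skel-Forward$(V,E,v)$. 3. $SCC\leftarrow\{v\}$; while $(\mathrm{Pre}(SCC)\cap FW)\setminus SCC\neq\emptyset$: $SCC\leftarrow SCC\cup(\mathrm{Pre}(SCC)\cap FW)$. Output $SCC$ as an SCC. 4. Call SCC-Find on the induced subgraph $G_{V\setminus FW}$ with skeleton $(\mathcal S\setminus SCC,\ w)$, where $w$ is the vertex of $(\mathrm{Pre}(SCC\cap\mathcal S)\setminus SCC)\cap\mathcal S$ (if any). 5. Call SCC-Find on the induced subgraph $G_{FW\setminus SCC}$ with skeleton $(\mathcal S'\setminus SCC,\ v')$. -}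

module Defs where

open import Data.Bool using (Bool; if_then_else_; not)
open import Data.Empty using (⊥; ⊥-elim)
open import Data.Fin using (Fin; zero; suc; toℕ; fromℕ<)
open import Data.Fin.Properties
  using (any?; all?; toℕ<n; toℕ-fromℕ<; toℕ≤pred[n]; pigeonhole)
  renaming (_≟_ to _≟ᶠ_)
open import Data.Fin.Subset
  using (Subset; inside; outside; _∈_; _⊆_; Nonempty; _∪_; _∩_; _─_; ⁅_⁆)
  renaming (⊥ to ∅)
open import Data.Fin.Subset.Properties using (_∈?_; _⊆?_; nonempty?; anySubset?)
open import Data.List
  using (List; []; _∷_; _++_; map; filter; allFin; cartesianProductWith)
open import Data.List.Extrema.Nat using (max)
open import Data.Maybe using (Maybe; just; nothing)
open import Data.Nat using (ℕ; zero; suc; _+_; _∸_; _≤_; _<_; z≤n; s≤s; _<?_)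
open import Data.Nat.Induction using (<-wellFounded)
open import Data.Nat.Properties
  using (≮⇒≥; m+[n∸m]≡n; +-monoˡ-<)
open import Data.Product using (_×_; _,_; ∃-syntax; proj₁)
open import Data.Vec using (tabulate)
import Data.Vec as Vec
open import Function using (_∘_)
open import Induction.WellFounded using (Acc; acc)
open import Level using (0ℓ)
open import Relation.Binary using (Rel; Decidable)
open import Relation.Binary.PropositionalEquality using (_≡_; refl; sym; subst)
open import Relation.Nullary using (Dec; yes; no; does; ¬?; _×-dec_)
open import Relation.Nullary.Decidable using (map′; _→-dec_; decidable-stable)

record Digraph (n : ℕ) : Set₁ where
  field
    _⟶_  : Rel (Fin n) 0ℓ
    _⟶?_ : Decidable _⟶_

allSubsets : ∀ n → List (Subset n)
allSubsets zero    = Vec.[] ∷ []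
allSubsets (suc n) =
  map (inside Vec.∷_) (allSubsets n) ++ map (outside Vec.∷_) (allSubsets n)

least : {P : ℕ → Set} → (∀ k → Dec (P k)) → ∀ k → P k →
        ∃[ m ] (P m × ∀ j → P j → m ≤ j)
least P? zero p = 0 , p , λ _ _ → z≤n
least P? (suc k) p with P? 0
... | yes p₀ = 0 , p₀ , λ _ _ → z≤n
... | no ¬p₀ with m , pₘ , minimal ← least (P? ∘ suc) k p =
  suc m , pₘ , λ { zero p₀ → ⊥-elim (¬p₀ p₀) ; (suc j) pⱼ → s≤s (minimal j pⱼ) }

module _ {n : ℕ} (G : Digraph n) where
  open Digraph G

  -- Path k u v: a path with k edges from u to v.  Vertices may repeat, which
  -- changes neither reachability nor distances.
  data Path : ℕ → Fin n → Fin n → Set where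
    []  : ∀ {u} → Path 0 u u
    _∷_ : ∀ {k u w v} → u ⟶ w → Path k w v → Path (suc k) u v

  Reach : Fin n → Fin n → Set
  Reach u v = ∃[ k ] Path k u v

  StronglyConnected : Subset n → Set
  StronglyConnected C = ∀ u v → u ∈ C → v ∈ C → Reach u v

  IsSCC : Subset n → Set
  IsSCC C = Nonempty C × StronglyConnected C
          × (∀ C′ → StronglyConnected C′ → C ⊆ C′ → C′ ⊆ C)

  path? : ∀ k u v → Dec (Path k u v)
  path? zero u v = map′ (λ { refl → [] }) (λ { [] → refl }) (u ≟ᶠ v)
  path? (suc k) u v = map′ (λ { (_ , e , p) → e ∷ p }) (λ { (e ∷ p) → _ , e , p })
    (any? λ w → (u ⟶? w) ×-dec path? k w v)

  private
    at : ∀ {k u v} → Path k u v → Fin (suc k) → Fin n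
    at {u = u} _       zero    = u
    at         (_ ∷ p) (suc i) = at p i

    before : ∀ {k u v} (p : Path k u v) (i : Fin (suc k)) → Path (toℕ i) u (at p i)
    before _       zero    = []
    before (e ∷ p) (suc i) = e ∷ before p i

    after : ∀ {k u v} (p : Path k u v) (i : Fin (suc k)) → Path (k ∸ toℕ i) (at p i) v
    after p       zero    = p
    after (_ ∷ p) (suc i) = after p i

    concat : ∀ {j k u w v} → Path j u w → Path k w v → Path (j + k) u v
    concat []      q = q
    concat (e ∷ p) q = e ∷ concat p q

    shorten : ∀ {k u v} → n ≤ k → Path k u v → ∃[ j ] (j < k × Path j u v)
    shorten {k} n≤k p with i , j , i<j , pᵢ≡pⱼ ← pigeonhole (s≤s n≤k) (at p) =
      toℕ i + (k ∸ toℕ j) ,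
      subst (toℕ i + (k ∸ toℕ j) <_) (m+[n∸m]≡n (toℕ≤pred[n] j)) (+-monoˡ-< (k ∸ toℕ j) i<j) ,
      concat (before p i) (subst (λ w → Path _ w _) (sym pᵢ≡pⱼ) (after p j))

    short : ∀ {k u v} → Acc _<_ k → Path k u v → ∃[ j ] (j < n × Path j u v)
    short {k} (acc rec) p with k <? n
    ... | yes k<n = k , k<n , p
    ... | no k≮n with _ , j<k , q ← shorten (≮⇒≥ k≮n) p = short (rec j<k) q

  reach? : ∀ u v → Dec (Reach u v)
  reach? u v = map′ (λ { (i , p) → toℕ i , p }) bounded (any? λ i → path? (toℕ i) u v)
    where
    bounded : Reach u v → ∃[ i ] Path (toℕ {n} i) u v
    bounded (k , p) with _ , j<n , q ← short (<-wellFounded k) p =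
      fromℕ< j<n , subst (λ l → Path l u v) (sym (toℕ-fromℕ< j<n)) q

  stronglyConnected? : ∀ C → Dec (StronglyConnected C)
  stronglyConnected? C = all? λ u → all? λ v →
    (u ∈? C) →-dec ((v ∈? C) →-dec reach? u v)

  isSCC? : ∀ C → Dec (IsSCC C)
  isSCC? C = nonempty? C ×-dec (stronglyConnected? C ×-dec maximal?)
    where
    larger? : ∀ C′ → Dec (StronglyConnected C′ → C ⊆ C′ → C′ ⊆ C)
    larger? C′ = stronglyConnected? C′ →-dec ((C ⊆? C′) →-dec (C′ ⊆? C))

    maximal? : Dec (∀ C′ → StronglyConnected C′ → C ⊆ C′ → C′ ⊆ C)
    maximal? = map′ (λ none C′ → decidable-stable (larger? C′) (λ ¬l → none (C′ , ¬l)))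
                    (λ all (C′ , ¬l) → ¬l (all C′))
                    (¬? (anySubset? (¬? ∘ larger?)))

  SCCs : List (Subset n)
  SCCs = filter isSCC? (allSubsets n)

  shortest : ∀ {u v} → Reach u v → ∃[ d ] (Path d u v × ∀ k → Path k u v → d ≤ k)
  shortest {u} {v} (k , p) = least (λ l → path? l u v) k p

  -- The value for unreachable v is irrelevant: it never occurs inside an SCC.
  dist : Fin n → Fin n → ℕ
  dist u v with reach? u v
  ... | yes r = proj₁ (shortest r)
  ... | no _  = 0

  diameter : Subset n → ℕ
  diameter C = max 0 (cartesianProductWith dist vertices vertices)
    where vertices = filter (_∈? C) (allFin n)

-- Computations over subsets of Fin n.  Each tick and each pick is one symbolic
-- operation; pick S f continues with f x for an arbitrary x ∈ S, and fail stands
-- for exhausted fuel or an undefined value.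
data Comp (n : ℕ) (A : Set) : Set where
  return : A → Comp n A
  fail   : Comp n A
  tick   : Comp n A → Comp n A
  pick   : Subset n → (Fin n → Comp n A) → Comp n A

infixl 1 _>>=_
_>>=_ : ∀ {n A B} → Comp n A → (A → Comp n B) → Comp n B
return a >>= g = g a
fail     >>= g = fail
tick m   >>= g = tick (m >>= g)
pick S f >>= g = pick S (λ x → f x >>= g)

-- Every Q m: whichever elements are picked, m terminates without failure, with a
-- result a and a number k of symbolic operations such that Q a k.
Every : ∀ {n A} → (A → ℕ → Set) → Comp n A → Set
Every Q (return a) = Q a 0
Every Q fail       = ⊥
Every Q (tick m)   = Every (λ a k → Q a (suc k)) m
Every Q (pick S f) = Nonempty S × (∀ x → x ∈ S → Every (λ a k → Q a (suc k)) (f x))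

module _ {n : ℕ} where

  union intersection difference : Subset n → Subset n → Comp n (Subset n)
  union        S T = tick (return (S ∪ T))
  intersection S T = tick (return (S ∩ T))
  difference   S T = tick (return (S ─ T))

  isEmpty : Subset n → Comp n Bool
  isEmpty S = tick (return (not (does (nonempty? S))))

  Pick : Subset n → Comp n (Fin n)
  Pick S = pick S return

  PickIfAny : Subset n → Comp n (Maybe (Fin n))
  PickIfAny S = do
    e ← isEmpty S
    if e then return nothing else (Pick S >>= λ x → return (just x))

  fromJust : Maybe (Fin n) → Comp n (Fin n)
  fromJust (just v) = return v
  fromJust nothing  = fail

module _ {n : ℕ} (G : Digraph n) where
  open Digraph G

  PreSet PostSet : Subset n → Subset n
  PreSet  S = tabulate λ v → does (any? λ s → (s ∈? S) ×-dec (v ⟶? s))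
  PostSet S = tabulate λ v → does (any? λ s → (s ∈? S) ×-dec (s ⟶? v))

  -- Pre and Post in the subgraph induced by U: a one-step operation in G followed
  -- by an intersection, hence two symbolic operations.
  Pre Post : Subset n → Subset n → Comp n (Subset n)
  Pre  U S = tick (return (PreSet S))  >>= λ P → intersection P U
  Post U S = tick (return (PostSet S)) >>= λ P → intersection P U

  -- First loop of Skel-Forward: Lᵢ is L[i] and Ls is L[i-1], …, L[0].  On exit
  -- L[i] is empty, so the head of the returned list is the last nonempty level.
  forward : ℕ → (U FW Lᵢ : Subset n) → List (Subset n) →
            Comp n (Subset n × List (Subset n))
  forward zero       U FW Lᵢ Ls = fail
  forward (suc fuel) U FW Lᵢ Ls = do
    e ← isEmpty Lᵢ
    if e then return (FW , Ls) else (do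
      FW′ ← union FW Lᵢ
      P   ← Post U Lᵢ
      L′  ← difference P FW′
      forward fuel U FW′ L′ (Lᵢ ∷ Ls))

  -- Second loop of Skel-Forward, over the remaining levels L[i-1], …, L[0].
  skeleton : (U S′ : Subset n) → List (Subset n) → Comp n (Subset n)
  skeleton U S′ []       = return S′
  skeleton U S′ (L ∷ Ls) = do
    P   ← Pre U S′
    I   ← intersection P L
    x   ← Pick I
    S″  ← union S′ ⁅ x ⁆
    skeleton U S″ Ls

  skelForward : ℕ → Subset n → Fin n → Comp n (Subset n × Subset n × Fin n)
  skelForward fuel U v = forward fuel U ∅ ⁅ v ⁆ [] >>= λ where
    (FW , [])     → fail
    (FW , L ∷ Ls) → do
      v′ ← Pick L
      S′ ← skeleton U ⁅ v′ ⁆ Ls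
      return (FW , S′ , v′)

  backward : ℕ → (U FW SCC : Subset n) → Comp n (Subset n)
  backward zero       U FW SCC = fail
  backward (suc fuel) U FW SCC = do
    P ← Pre U SCC
    B ← intersection P FW
    N ← difference B SCC
    e ← isEmpty N
    if e then return SCC else (do
      P′   ← Pre U SCC
      B′   ← intersection P′ FW
      SCC′ ← union SCC B′
      backward fuel U FW SCC′)

  -- SCC-Find on the subgraph induced by U with skeleton (S , v), returning the
  -- SCCs in the order in which they are output.  The vertex of an empty skeleton
  -- is never read, so it may be nothing.  fuel bounds the recursion depth and
  -- the number of iterations of each loop.
  sccFind : ℕ → Subset n → Subset n × Maybe (Fin n) → Comp n (List (Subset n))
  sccFind zero       U (S , v?) = fail
  sccFind (suc fuel) U (S , v?) = do
    e ← isEmpty U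
    if e then return [] else (do
      s  ← isEmpty S
      v  ← (if s then Pick U else fromJust v?)
      (FW , S′ , v′) ← skelForward fuel U v
      SCC ← backward fuel U FW ⁅ v ⁆
      T  ← intersection SCC S
      P  ← Pre U T
      N  ← difference P SCC
      W  ← intersection N S
      w? ← PickIfAny W
      U₁ ← difference U FW
      S₁ ← difference S SCC
      outputs₁ ← sccFind fuel U₁ (S₁ , w?)
      U₂ ← difference FW SCC
      S₂ ← difference S′ SCC
      outputs₂ ← sccFind fuel U₂ (S₂ , just v′)
      return (SCC ∷ outputs₁ ++ outputs₂))

{-# OPTIONS --safe #-}

-- Every subgraph on which SCC-Find is called is induced by a convex set U (a path of G between two
-- vertices of U stays in U), so that reachability, distances and SCCs may all be taken in G.  A
-- skeleton is the vertex set of a shortest path of G ending in v.  Such a path meets the SCC C of v in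
-- a shortest path, hence in at most 1 + D_C vertices, and what remains outside C is again a shortest
-- path.  The levels of the forward search are as many as the vertices of the new skeleton; each of
-- these is charged to the SCC that contains it, where it is met once.  The i-th round of the backward
-- search finds a vertex of C at distance i from v, so there are at most D_C successful rounds.

module Submission where

open import Defs
open import Data.Bool using (if_then_else_; not)
open import Data.Fin using (Fin; zero; suc)
open import Data.Fin.Properties using (any?)
open import Data.Fin.Subset
  using (Subset; inside; outside; _∈_; _∉_; _⊆_; Nonempty; Empty; _∪_; _∩_; _─_; ⁅_⁆; ∣_∣; ⊤; ⊥)
open import Data.Fin.Subset.Properties
  using (_∈?_; nonempty?; ∉⊥; ∈⊤; x∈⁅x⁆; x∈⁅y⁆⇒x≡y; ⊆-antisym; p⊆q⇒∣p∣≤∣q∣; p⊂q⇒∣p∣<∣q∣;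
         ∣p∣≤n; x∈p∩q⁺; x∈p∩q⁻; x∈p∪q⁻; x∈p∪q⁺; p─q⊆p; x∈p∧x∉q⇒x∈p─q)
open import Data.List using (List; []; _∷_; _++_; filter; allFin; length; map; sum)
open import Data.List.Extrema.Nat using (xs≤max)
import Data.List.Membership.Propositional as List
open import Data.List.Membership.Propositional.Properties
  using (∈-map⁺; ∈-map⁻; ∈-++⁺ˡ; ∈-++⁺ʳ; ∈-++⁻; ∈-filter⁺; ∈-filter⁻; ∈-allFin; ∈-cartesianProductWith⁺)
open import Data.List.Membership.Propositional.Properties.WithK using (unique∧set⇒bag)
open import Data.List.Properties using (length-++; map-++)
open import Data.Nat.ListAction.Properties using (sum-++; sum-↭)
open import Data.List.Relation.Binary.BagAndSetEquality using (∼bag⇒↭)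
open import Data.List.Relation.Binary.Permutation.Propositional using (_↭_)
open import Data.List.Relation.Binary.Permutation.Propositional.Properties using (↭-length; map⁺)
import Data.List.Relation.Unary.All as All
open import Data.List.Relation.Unary.All using ([]; _∷_)
open import Data.List.Relation.Unary.AllPairs using ([]; _∷_)
open import Data.List.Relation.Unary.Any using (here; there)
open import Data.List.Relation.Unary.Unique.Propositional using (Unique)
import Data.List.Relation.Unary.Unique.Propositional.Properties as Unique
open import Data.Maybe using (Maybe; just; nothing)
open import Data.Nat using (ℕ; zero; suc; NonZero; _+_; _*_; _≤_; _<_; z≤n; s≤s; z<s; s<s; s≤s⁻¹)
open import Data.Nat.Properties
open import Data.Nat.Tactic.RingSolver using (solve-∀)
open import Data.Product using (_×_; _,_; ∃-syntax; proj₁; proj₂)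
open import Data.Sum using (_⊎_; inj₁; inj₂; map₁)
open import Data.Vec using (tabulate)
import Data.Vec as Vec
open import Data.Vec.Properties using (lookup∘tabulate; []=⇒lookup; lookup⇒[]=)
open import Function using (_∘_; _⇔_; mk⇔; Equivalence)
open import Relation.Binary.PropositionalEquality using (_≡_; refl; sym; trans; cong; cong₂; subst)
open import Relation.Nullary using (Dec; yes; no; does; ¬_; ¬?; contradiction)
open import Relation.Nullary.Decidable using (dec-true; _×-dec_; decidable-stable)

open Equivalence

-- Membership in finite subsets and their enumeration.

∈-tabulate : ∀ {n} {P : Fin n → Set} (P? : ∀ x → Dec (P x)) {x} →
             x ∈ tabulate (λ y → does (P? y)) ⇔ P x
∈-tabulate {P = P} P? {x} = mk⇔ sound complete
  where
  sound : x ∈ tabulate (λ y → does (P? y)) → P x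
  sound x∈ with P? x | trans (sym (lookup∘tabulate (λ y → does (P? y)) x)) ([]=⇒lookup x∈)
  ... | yes p | _ = p
  complete : P x → x ∈ tabulate (λ y → does (P? y))
  complete p = lookup⇒[]= x _ (trans (lookup∘tabulate _ x) (dec-true (P? x) p))

∈-allSubsets : ∀ {n} (S : Subset n) → S List.∈ allSubsets n
∈-allSubsets Vec.[]              = here refl
∈-allSubsets (inside  Vec.∷ S) = ∈-++⁺ˡ (∈-map⁺ (inside Vec.∷_) (∈-allSubsets S))
∈-allSubsets (outside Vec.∷ S) = ∈-++⁺ʳ (map (inside Vec.∷_) (allSubsets _)) (∈-map⁺ (outside Vec.∷_) (∈-allSubsets S))

allSubsets-unique : ∀ n → Unique (allSubsets n)
allSubsets-unique zero    = [] ∷ []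
allSubsets-unique (suc n) = Unique.++⁺
  (Unique.map⁺ (λ { refl → refl }) (allSubsets-unique n))
  (Unique.map⁺ (λ { refl → refl }) (allSubsets-unique n))
  λ (in∈ , out∈) → disjoint (∈-map⁻ (inside Vec.∷_) in∈) (∈-map⁻ (outside Vec.∷_) out∈)
  where
  disjoint : ∀ {S : Subset (suc n)} → ∃[ T ] (T List.∈ allSubsets n × S ≡ inside Vec.∷ T) →
             ¬ (∃[ T ] (T List.∈ allSubsets n × S ≡ outside Vec.∷ T))
  disjoint (_ , _ , refl) (_ , _ , ())

x∈p─q⇒x∉q : ∀ {n} (p q : Subset n) {x} → x ∈ p ─ q → x ∉ q
x∈p─q⇒x∉q (_ Vec.∷ _) (inside  Vec.∷ _) {zero} () Vec.here
x∈p─q⇒x∉q (_ Vec.∷ p) (inside  Vec.∷ q) {suc x} (Vec.there x∈) (Vec.there x∈q) = x∈p─q⇒x∉q p q x∈ x∈q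
x∈p─q⇒x∉q (_ Vec.∷ p) (outside Vec.∷ q) {suc x} (Vec.there x∈) (Vec.there x∈q) = x∈p─q⇒x∉q p q x∈ x∈q

∈-─⁻ : ∀ {n} (p q : Subset n) {x} → x ∈ p ─ q → x ∈ p × x ∉ q
∈-─⁻ p q x∈ = p─q⊆p p q x∈ , x∈p─q⇒x∉q p q x∈

-- The progress measure of both search loops: a round that continues collects a vertex not collected
-- before.
∣p∣<∣p∪q∣ : ∀ {n} (p q : Subset n) {x} → x ∈ q → x ∉ p → ∣ p ∣ < ∣ p ∪ q ∣
∣p∣<∣p∪q∣ p q x∈q x∉p = p⊂q⇒∣p∣<∣q∣ ((λ y∈p → x∈p∪q⁺ (inj₁ y∈p)) , _ , x∈p∪q⁺ (inj₂ x∈q) , x∉p)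

-- Compositional reasoning about results and costs.

Every-map : ∀ {n A} {P Q : A → ℕ → Set} (m : Comp n A) →
            (∀ {a k} → P a k → Q a k) → Every P m → Every Q m
Every-map (return a) f p       = f p
Every-map (tick m)   f p       = Every-map m f p
Every-map (pick S g) f (S≢∅ , p) = S≢∅ , λ x x∈S → Every-map (g x) f (p x x∈S)

-- The cost `k` of the first computation is the left summand, so `suc k + j` reduces and no clause
-- needs rewriting.
Every->>= : ∀ {n A B} {P : A → ℕ → Set} {Q : B → ℕ → Set} (m : Comp n A) {g : A → Comp n B} →
            Every P m → (∀ a k → P a k → Every (λ b j → Q b (k + j)) (g a)) → Every Q (m >>= g)
Every->>= (return a) p f         = f a 0 p
Every->>= (tick m)   p f         = Every->>= m p λ a k → f a (suc k)
Every->>= (pick S g) (S≢∅ , p) f = S≢∅ , λ x x∈S → Every->>= (g x) (p x x∈S) λ a k → f a (suc k)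

Every-ifEmpty : ∀ {n A} {Q : A → ℕ → Set} (S : Subset n) {m m′ : Comp n A} →
                (Empty S → Every Q m) → (Nonempty S → Every Q m′) →
                Every Q (if not (does (nonempty? S)) then m else m′)
Every-ifEmpty S f g with nonempty? S
... | yes S≢∅ = g S≢∅
... | no  S≡∅ = f S≡∅

-- Paths and their decompositions.

module _ {n : ℕ} {G : Digraph n} where
  open Digraph G

  infixr 5 _◅◅_
  _◅◅_ : ∀ {j k u w v} → Path G j u w → Path G k w v → Path G (j + k) u v
  []      ◅◅ q = q
  (e ∷ p) ◅◅ q = e ∷ (p ◅◅ q)

  snoc : ∀ {k u w v} → Path G k u w → w ⟶ v → Path G (suc k) u v
  snoc []      f = f ∷ []
  snoc (e ∷ p) f = e ∷ snoc p f

  unsnoc : ∀ {k u v} → Path G (suc k) u v → ∃[ w ] (Path G k u w × w ⟶ v)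
  unsnoc (e ∷ [])          = _ , [] , e
  unsnoc (e ∷ p@(_ ∷ _)) with w , q , f ← unsnoc p = w , e ∷ q , f

  reach-trans : ∀ {u w v} → Reach G u w → Reach G w v → Reach G u v
  reach-trans (_ , p) (_ , q) = _ , p ◅◅ q

  reach-refl : ∀ {u} → Reach G u u
  reach-refl = 0 , []

  edge-reach : ∀ {u v} → u ⟶ v → Reach G u v
  edge-reach e = 1 , e ∷ []

  data On (x : Fin n) : ∀ {k u v} → Path G k u v → Set where
    start : ∀ {k v} {p : Path G k x v} → On x p
    later : ∀ {k u w v} {e : u ⟶ w} {p : Path G k w v} → On x p → On x (e ∷ p)

  on-end : ∀ {k u v} (p : Path G k u v) → On v p
  on-end []      = start
  on-end (_ ∷ p) = later (on-end p)

  -- The end vertex is split off so that every other vertex comes with a strictly shorter path;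
  -- strictness later contradicts the minimality of a shortest path.
  prefix : ∀ {k u v x} {p : Path G k u v} → On x p → x ≡ v ⊎ ∃[ l ] (l < k × Path G l u x)
  prefix {p = []}    start = inj₁ refl
  prefix {p = _ ∷ _} start = inj₂ (0 , z<s , [])
  prefix {p = e ∷ _} (later o) with prefix o
  ... | inj₁ x≡v           = inj₁ x≡v
  ... | inj₂ (l , l<k , q) = inj₂ (suc l , s<s l<k , e ∷ q)

  suffix : ∀ {k u v x} {p : Path G k u v} → On x p → x ≡ u ⊎ ∃[ l ] (l < k × Path G l x v)
  suffix start = inj₁ refl
  suffix {p = _ ∷ p} (later o) with suffix o
  ... | inj₁ refl          = inj₂ (_ , ≤-refl , p)
  ... | inj₂ (l , l<k , q) = inj₂ (l , m<n⇒m<1+n l<k , q)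

  prefix-≤ : ∀ {k u v x} {p : Path G k u v} → On x p → ∃[ l ] (l ≤ k × Path G l u x)
  prefix-≤ {p = p} o with prefix o
  ... | inj₁ refl          = _ , ≤-refl , p
  ... | inj₂ (l , l<k , q) = l , <⇒≤ l<k , q

  suffix-≤ : ∀ {k u v x} {p : Path G k u v} → On x p → ∃[ l ] (l ≤ k × Path G l x v)
  suffix-≤ {p = p} o with suffix o
  ... | inj₁ refl          = _ , ≤-refl , p
  ... | inj₂ (l , l<k , q) = l , <⇒≤ l<k , q

  on-reachˡ : ∀ {k u v x} {p : Path G k u v} → On x p → Reach G u x
  on-reachˡ o with l , _ , q ← prefix-≤ o = l , q

  on-reachʳ : ∀ {k u v x} {p : Path G k u v} → On x p → Reach G x v
  on-reachʳ o with l , _ , q ← suffix-≤ o = l , q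

  -- The path is cut at its first edge that leaves `P`, as `all` and `exit` express; the `on` fields
  -- relate its vertices to those of the two pieces. It is used with `P` a component and with `P`
  -- the complement of one.
  record Crossing (P : Fin n → Set) {k u v} (p : Path G k u v) : Set where
    constructor crossing
    field
      {a b}  : ℕ
      {w t}  : Fin n
      before : Path G a u w
      edge   : w ⟶ t
      after  : Path G b t v
      length≡ : k ≡ a + suc b
      on⁻    : ∀ {x} → On x p → On x before ⊎ On x after
      on⁺ˡ   : ∀ {x} → On x before → On x p
      on⁺ʳ   : ∀ {x} → On x after → On x p
      all    : ∀ {x} → On x before → P x
      exit   : ¬ P t

  cross : ∀ {P : Fin n → Set} → (∀ x → Dec (P x)) →
          ∀ {k u v} (p : Path G k u v) → P u → ¬ P v → Crossing P p
  cross P? [] Pu ¬Pv = contradiction Pu ¬Pv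
  cross P? (_∷_ {w = t} e p) Pu ¬Pv with P? t
  ... | no ¬Pt = crossing [] e p refl (λ { start → inj₁ start ; (later o) → inj₂ o })
                   (λ { start → start }) later (λ { start → Pu }) ¬Pt
  ... | yes Pt with cross P? p Pt ¬Pv
  ... | crossing q f r len on⁻ on⁺ˡ on⁺ʳ all exit =
    crossing (e ∷ q) f r (cong suc len)
      (λ { start → inj₁ start ; (later o) → map₁ later (on⁻ o) })
      (λ { start → start ; (later o) → later (on⁺ˡ o) }) (later ∘ on⁺ʳ)
      (λ { start → Pu ; (later o) → all o }) exit

module _ {n : ℕ} (G : Digraph n) where
  open Digraph G

  -- Distances, convex sets and strongly connected components.

  Distance : ℕ → Fin n → Fin n → Set
  Distance k u v = Path G k u v × (∀ j → Path G j u v → k ≤ j)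

  distance≤dist : ∀ {k u v} → Distance k u v → k ≤ dist G u v
  distance≤dist {k} {u} {v} (p , minimal) with reach? G u v
  ... | yes r with _ , q , _ ← shortest G r = minimal _ q
  ... | no ¬r = contradiction (k , p) ¬r

  distance≤diameter : ∀ {k u v C} → u ∈ C → v ∈ C → Distance k u v → k ≤ diameter G C
  distance≤diameter {C = C} u∈C v∈C d = ≤-trans (distance≤dist d)
    (All.lookup (xs≤max 0 _) (∈-cartesianProductWith⁺ (dist G) (vertex u∈C) (vertex v∈C)))
    where
    vertex : ∀ {x} → x ∈ C → x List.∈ filter (_∈? C) (allFin n)
    vertex {x} x∈C = ∈-filter⁺ (_∈? C) (∈-allFin x) x∈C

  Convex : Subset n → Set
  Convex U = ∀ {x y z} → x ∈ U → y ∈ U → Reach G x z → Reach G z y → z ∈ U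

  component : Fin n → Subset n
  component v = tabulate λ x → does (reach? G v x ×-dec reach? G x v)

  ∈-component : ∀ {v x} → x ∈ component v ⇔ (Reach G v x × Reach G x v)
  ∈-component {v} = ∈-tabulate λ x → reach? G v x ×-dec reach? G x v

  v∈component : ∀ {v} → v ∈ component v
  v∈component = from ∈-component (reach-refl , reach-refl)

  component-convex : ∀ {v} → Convex (component v)
  component-convex x∈ y∈ x→z z→y with v→x , _ ← to ∈-component x∈ | _ , y→v ← to ∈-component y∈ =
    from ∈-component (reach-trans v→x x→z , reach-trans z→y y→v)

  -- A convex set is a union of components, so the SCCs of the subgraph it induces are the SCCs of
  -- `G` contained in it.
  component⊆ : ∀ {U v} → Convex U → v ∈ U → component v ⊆ U
  component⊆ convex v∈U x∈ with v→x , x→v ← to ∈-component x∈ = convex v∈U v∈U v→x x→v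

  component-isSCC : ∀ {v} → IsSCC G (component v)
  component-isSCC = (_ , v∈component) ,
    (λ _ _ u∈ v∈ → reach-trans (proj₂ (to ∈-component u∈)) (proj₁ (to ∈-component v∈))) ,
    λ _ sc ⊆C x∈ → from ∈-component (sc _ _ (⊆C v∈component) x∈ , sc _ _ x∈ (⊆C v∈component))

  isSCC⇒component : ∀ {C v} → IsSCC G C → v ∈ C → C ≡ component v
  isSCC⇒component {C} {v} (_ , sc , maximal) v∈C = ⊆-antisym C⊆ (maximal _ (proj₁ (proj₂ component-isSCC)) C⊆)
    where
    C⊆ : C ⊆ component v
    C⊆ x∈C = from ∈-component (sc _ _ v∈C x∈C , sc _ _ x∈C v∈C)

  ∈-PreSet : ∀ {S x} → x ∈ PreSet G S ⇔ (∃[ s ] (s ∈ S × x ⟶ s))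
  ∈-PreSet {S} = ∈-tabulate λ x → any? λ s → (s ∈? S) ×-dec (x ⟶? s)

  ∈-PostSet : ∀ {S x} → x ∈ PostSet G S ⇔ (∃[ s ] (s ∈ S × s ⟶ x))
  ∈-PostSet {S} = ∈-tabulate λ x → any? λ s → (s ∈? S) ×-dec (s ⟶? x)

  IsForward : Subset n → Fin n → Subset n → Set
  IsForward U v FW = ∀ {x} → x ∈ FW ⇔ (x ∈ U × Reach G v x)

  IsVertexSet : ∀ {k u v} → Subset n → Path G k u v → Set
  IsVertexSet S p = ∀ {x} → x ∈ S ⇔ On x p

  -- The forward search and its levels.

  module Search {U : Subset n} (convex : Convex U) {v : Fin n} (v∈U : v ∈ U) where

    -- The bound is strict: before level `i` is added, `FW` holds the vertices of `U` at distance
    -- below `i`, and `Near 0` matches the initial empty set.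
    Near : ℕ → Fin n → Set
    Near i x = ∃[ k ] (k < i × Path G k v x)

    IsLevel : ℕ → Subset n → Set
    IsLevel i L = ∀ {x} → x ∈ L ⇔ (x ∈ U × Distance i v x)

    data Levels : ℕ → List (Subset n) → Set where
      []  : Levels 0 []
      _∷_ : ∀ {i L Ls} → IsLevel i L × Nonempty L → Levels i Ls → Levels (suc i) (L ∷ Ls)

    predecessor : ∀ {i x} → x ∈ U → Distance (suc i) v x → ∃[ y ] (y ∈ U × Distance i v y × y ⟶ x)
    predecessor x∈U (p , minimal) with y , q , e ← unsnoc p =
      y , convex v∈U x∈U (_ , q) (edge-reach e) , (q , λ k r → s≤s⁻¹ (minimal _ (snoc r e))) , e

    -- A round costs five operations and `i` rounds are already done; `suc l` is the final number of
    -- levels, and the last 1 is the emptiness test that ends the loop.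
    ForwardResult : ℕ → Subset n × List (Subset n) → ℕ → Set
    ForwardResult i (FW , Ls) k = IsForward U v FW × ∃[ l ] (Levels (suc l) Ls × k + 5 * i ≤ 5 * suc l + 1)

    finish : ∀ {k i FW Ls} → k < i → IsForward U v FW → Levels i Ls → ForwardResult i (FW , Ls) 1
    finish {i = suc l} _ isFW levels = isFW , l , levels , ≤-reflexive (+-comm 1 (5 * suc l))

    -- A round spends one unit of fuel and adds a nonempty new level to `FW`, so `fuel + ∣ FW ∣`
    -- never decreases; with no fuel left, `FW` would be larger than `U`.
    forward-correct : ∀ fuel {i FW L Ls} → ∣ U ∣ < fuel + ∣ FW ∣ →
                      (∀ {x} → x ∈ FW ⇔ (x ∈ U × Near i x)) → IsLevel i L → Levels i Ls →
                      Every (ForwardResult i) (forward G fuel U FW L Ls)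
    forward-correct zero {FW = FW} enough fw level levels =
      contradiction (p⊆q⇒∣p∣≤∣q∣ (λ x∈ → proj₁ (to fw x∈))) (<⇒≱ enough)
    forward-correct (suc fuel) {i} {FW} {L} {Ls} enough fw level levels =
      Every-ifEmpty L exhausted continue
      where
      -- If level `i` is empty, every path from `v` to a vertex of `U` can be replaced by one with
      -- fewer than `i` edges: `arrived` extends a replacement by one edge, and `near` excludes that
      -- exactly `i` edges are necessary.
      arrived : Empty L → ∀ k {x} → x ∈ U → Path G k v x → Near i x
      near : Empty L → ∀ {k x} → x ∈ U → Path G k v x → k ≤ i → Near i x
      near L≡∅ {x = x} x∈U p k≤i with x ∈? FW
      ... | yes x∈FW = proj₂ (to fw x∈FW)
      ... | no  x∉FW with m≤n⇒m<n∨m≡n k≤i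
      ... | inj₁ k<i = contradiction (from fw (x∈U , _ , k<i , p)) x∉FW
      ... | inj₂ refl = contradiction
        (x , from level (x∈U , p , λ j q → ≮⇒≥ λ j<i → x∉FW (from fw (x∈U , j , j<i , q)))) L≡∅
      arrived L≡∅ zero    x∈U p = near L≡∅ x∈U p z≤n
      arrived L≡∅ (suc k) x∈U p
        with y , q , e ← unsnoc p
        with j , j<i , r ← arrived L≡∅ k (convex v∈U x∈U (_ , q) (edge-reach e)) q =
        near L≡∅ x∈U (snoc r e) j<i

      exhausted : Empty L → ForwardResult i (FW , Ls) 1
      -- The path of length 0 shows that `v` is near, hence `i` is positive and some level exists.
      exhausted L≡∅ = finish (proj₁ (proj₂ (arrived L≡∅ 0 v∈U []))) isFW levels
        where
        isFW : IsForward U v FW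
        isFW = mk⇔ (λ x∈ → let x∈U , j , _ , p = to fw x∈ in x∈U , j , p)
                   (λ (x∈U , k , p) → from fw (x∈U , arrived L≡∅ k x∈U p))

      FW′ = FW ∪ L
      L′  = (PostSet G L ∩ U) ─ FW′

      fw′ : ∀ {x} → x ∈ FW′ ⇔ (x ∈ U × Near (suc i) x)
      fw′ = mk⇔ sound complete
        where
        sound : ∀ {x} → x ∈ FW′ → x ∈ U × Near (suc i) x
        sound x∈ with x∈p∪q⁻ FW L x∈
        ... | inj₁ x∈FW with x∈U , k , k<i , p ← to fw x∈FW = x∈U , k , m<n⇒m<1+n k<i , p
        ... | inj₂ x∈L with x∈U , p , _ ← to level x∈L = x∈U , i , ≤-refl , p
        complete : ∀ {x} → x ∈ U × Near (suc i) x → x ∈ FW′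
        complete {x} (x∈U , k , k<1+i , p) with x ∈? FW
        ... | yes x∈FW = x∈p∪q⁺ (inj₁ x∈FW)
        ... | no  x∉FW = x∈p∪q⁺ (inj₂ (from level (x∈U , subst (λ k → Path G k v x)
                           (≤-antisym (s≤s⁻¹ k<1+i) (far _ p)) p , far)))
          where
          far : ∀ j → Path G j v x → i ≤ j
          far j q = ≮⇒≥ λ j<i → x∉FW (from fw (x∈U , j , j<i , q))

      level′ : IsLevel (suc i) L′
      level′ = mk⇔ sound complete
        where
        sound : ∀ {x} → x ∈ L′ → x ∈ U × Distance (suc i) v x
        sound x∈
          with x∈P , x∉FW′ ← ∈-─⁻ (PostSet G L ∩ U) FW′ x∈
          with x∈Post , x∈U ← x∈p∩q⁻ (PostSet G L) U x∈P
          with s , s∈L , e ← to ∈-PostSet x∈Post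
          with _ , p , _ ← to level s∈L =
          x∈U , snoc p e , λ j q → ≮⇒≥ λ j<1+i → x∉FW′ (from fw′ (x∈U , j , j<1+i , q))
        complete : ∀ {x} → x ∈ U × Distance (suc i) v x → x ∈ L′
        complete (x∈U , d) with y , y∈U , d′ , e ← predecessor x∈U d =
          x∈p∧x∉q⇒x∈p─q (x∈p∩q⁺ (from ∈-PostSet (y , from level (y∈U , d′) , e) , x∈U))
            λ x∈FW′ → let _ , k , k<1+i , p = to fw′ x∈FW′ in <⇒≱ k<1+i (proj₂ d k p)

      enough′ : Nonempty L → ∣ U ∣ < fuel + ∣ FW′ ∣
      enough′ (x , x∈L) = begin-strict
        ∣ U ∣              <⟨ enough ⟩
        suc fuel + ∣ FW ∣  ≡⟨ +-suc fuel ∣ FW ∣ ⟨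
        fuel + suc ∣ FW ∣  ≤⟨ +-monoʳ-≤ fuel (∣p∣<∣p∪q∣ FW L x∈L λ x∈FW →
                                let _ , k , k<i , p = to fw x∈FW
                                    _ , _ , minimal = to level x∈L in <⇒≱ k<i (minimal k p)) ⟩
        fuel + ∣ FW′ ∣     ∎
        where open ≤-Reasoning

      continue : Nonempty L → _
      continue L≢∅ = Every-map (forward G fuel U FW′ L′ (L ∷ Ls)) charge
        (forward-correct fuel (enough′ L≢∅) fw′ level′ ((level , L≢∅) ∷ levels))
        where
        shift : ∀ k i → k + 5 * suc i ≡ suc (suc (suc (suc (suc k)))) + 5 * i
        shift = solve-∀
        charge : ∀ {r k} → ForwardResult (suc i) r k → ForwardResult i r (5 + k)
        charge {k = k} (isFW , l , levels , cost) =
          isFW , l , levels , subst (_≤ 5 * suc l + 1) (shift k i) cost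

    -- The skeleton traced back through the levels.

    SkeletonResult : ℕ → Fin n → ℕ → Subset n → ℕ → Set
    SkeletonResult l v′ i S′ k = (∃[ p ] IsVertexSet {l} {v} {v′} S′ p) × k ≤ 5 * i

    -- `p` is the part built so far; by `i + m ≡ l`, any path with `i` edges from `v` to `u`
    -- followed by `p` is shortest. `Pick` may return any vertex of the level below with an edge
    -- into `S′`, but minimality forces that edge to lead to `u`.
    skeleton-correct : ∀ {i m l v′ S′ u Ls} → i + m ≡ l → Distance l v v′ → u ∈ U → Distance i v u →
                       (p : Path G m u v′) → IsVertexSet S′ p → Levels i Ls →
                       Every (SkeletonResult l v′ i) (skeleton G U S′ Ls)
    skeleton-correct refl _ _ ([] , _) p isVS [] = (p , isVS) , z≤n
    skeleton-correct {suc i} {m} {l} {v′} {S′} {u} {L ∷ Ls} refl v→v′@(_ , minimal) u∈U d p isVS ((level , _) ∷ levels)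
      with predecessor u∈U d
    ... | y , y∈U , d′ , e =
      (y , x∈p∩q⁺ (x∈p∩q⁺ (from ∈-PreSet (u , from isVS start , e) , y∈U) , from level (y∈U , d′))) , step
      where
      -- An edge to a later vertex of `p` would bypass `u` and give a path to `v′` with fewer than
      -- `l` edges.
      only : ∀ {x s} → Path G i v x → x ⟶ s → On s p → s ≡ u
      only q f o with suffix o
      ... | inj₁ s≡u           = s≡u
      ... | inj₂ (j , j<m , r) = contradiction (minimal _ (q ◅◅ f ∷ r))
              (<⇒≱ (subst (_< suc (i + m)) (sym (+-suc i j)) (s<s (+-monoʳ-< i j<m))))

      extend : ∀ {x} (f : x ⟶ u) → IsVertexSet (S′ ∪ ⁅ x ⁆) (f ∷ p)
      extend {x} f = mk⇔ sound complete
        where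
        sound : ∀ {z} → z ∈ S′ ∪ ⁅ x ⁆ → On z (f ∷ p)
        sound z∈ with x∈p∪q⁻ S′ ⁅ x ⁆ z∈
        ... | inj₁ z∈S′ = later (to isVS z∈S′)
        ... | inj₂ z∈x with refl ← x∈⁅y⁆⇒x≡y x z∈x = start
        complete : ∀ {z} → On z (f ∷ p) → z ∈ S′ ∪ ⁅ x ⁆
        complete start     = x∈p∪q⁺ (inj₂ (x∈⁅x⁆ x))
        complete (later o) = x∈p∪q⁺ (inj₁ (from isVS o))

      charge : ∀ {S k} → SkeletonResult l v′ i S k → SkeletonResult l v′ (suc i) S (5 + k)
      charge {k = k} (path , cost) = path , subst (5 + k ≤_) (sym (*-suc 5 i)) (+-monoʳ-≤ 5 cost)

      step : ∀ x → x ∈ (PreSet G S′ ∩ U) ∩ L → _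
      step x x∈
        with x∈P , x∈L ← x∈p∩q⁻ (PreSet G S′ ∩ U) L x∈
        with s , s∈S′ , f ← to ∈-PreSet (proj₁ (x∈p∩q⁻ (PreSet G S′) U x∈P))
        with x∈U , d″ ← to level x∈L
        with refl ← only (proj₁ d″) f (to isVS s∈S′) =
        Every-map (skeleton G U (S′ ∪ ⁅ x ⁆) Ls) charge
          (skeleton-correct (+-suc i m) v→v′ x∈U d″ (f ∷ p) (extend f) levels)

    -- `suc l` is both the number of levels and the number of vertices of the new skeleton, so each
    -- skeleton vertex pays ten operations.
    SkelForwardResult : Subset n × Subset n × Fin n → ℕ → Set
    SkelForwardResult (FW , S′ , v′) k =
      IsForward U v FW × ∃[ l ] (v′ ∈ U × Distance l v v′ × (∃[ p ] IsVertexSet {l} {v} {v′} S′ p) × k ≤ 10 * suc l)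

    skelForward-correct : ∀ {fuel} → ∣ U ∣ < fuel → Every SkelForwardResult (skelForward G fuel U v)
    skelForward-correct {fuel} enough =
      Every->>= {P = ForwardResult 0} (forward G fuel U ⊥ ⁅ v ⁆ [])
        (forward-correct fuel enough′ fw₀ level₀ []) λ where
          -- The index `suc l` of `Levels` excludes the empty list, on which `skelForward` would
          -- fail.
          (FW , L ∷ Ls) k (isFW , l , (level , L≢∅) ∷ levels , cost) → L≢∅ , λ v′ v′∈L →
            let v′∈U , d = to level v′∈L in
            Every->>= {P = SkeletonResult l v′ l} (skeleton G U ⁅ v′ ⁆ Ls)
              (skeleton-correct (+-identityʳ l) d v′∈U d [] singleton levels)
              (λ S′ _ → gather k {S′ = S′} isFW v′∈U d cost)
      where
      bound : ∀ k j l → k + 0 ≤ 5 * suc l + 1 → j ≤ 5 * l → k + suc (j + 0) ≤ 10 * suc l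
      bound k j l k≤ j≤ = begin
        k + suc (j + 0)                ≡⟨ eq₁ k j ⟩
        (k + 0) + (j + 1)              ≤⟨ +-mono-≤ k≤ (+-monoˡ-≤ 1 j≤) ⟩
        -- The two loops and the pick between them take at most `10 * l + 7` operations; adding 3
        -- rounds this up.
        (5 * suc l + 1) + (5 * l + 1)  ≤⟨ m≤m+n _ 3 ⟩
        (5 * suc l + 1) + (5 * l + 1) + 3 ≡⟨ eq₂ l ⟩
        10 * suc l                     ∎
        where
        open ≤-Reasoning
        eq₁ : ∀ k j → k + suc (j + 0) ≡ (k + 0) + (j + 1)
        eq₁ = solve-∀
        eq₂ : ∀ l → (5 * suc l + 1) + (5 * l + 1) + 3 ≡ 10 * suc l
        eq₂ = solve-∀
      gather : ∀ k {FW l v′ S′ j} → IsForward U v FW → v′ ∈ U → Distance l v v′ → k + 0 ≤ 5 * suc l + 1 →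
               SkeletonResult l v′ l S′ j → SkelForwardResult (FW , S′ , v′) (k + suc (j + 0))
      gather k {l = l} {j = j} isFW v′∈U d cost (path , cost′) = isFW , l , v′∈U , d , path , bound k j l cost cost′
      enough′ : ∣ U ∣ < fuel + ∣ ⊥ {n} ∣
      enough′ = ≤-trans enough (m≤m+n fuel _)
      fw₀ : ∀ {x} → x ∈ ⊥ ⇔ (x ∈ U × Near 0 x)
      fw₀ = mk⇔ (λ x∈ → contradiction x∈ ∉⊥) λ ()
      level₀ : IsLevel 0 ⁅ v ⁆
      level₀ = mk⇔ sound (λ { (_ , [] , _) → x∈⁅x⁆ v })
        where
        sound : ∀ {x} → x ∈ ⁅ v ⁆ → x ∈ U × Distance 0 v x
        sound x∈ with refl ← x∈⁅y⁆⇒x≡y v x∈ = v∈U , [] , λ _ _ → z≤n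
      singleton : ∀ {x} → IsVertexSet ⁅ x ⁆ ([] {u = x})
      singleton {x} = mk⇔ sound (λ { start → x∈⁅x⁆ x })
        where
        sound : ∀ {z} → z ∈ ⁅ x ⁆ → On z ([] {u = x})
        sound z∈ with refl ← x∈⁅y⁆⇒x≡y x z∈ = start

    -- The backward search.

    BackwardResult : ℕ → Subset n → ℕ → Set
    BackwardResult i C k = C ≡ component v × k + 9 * i ≤ 9 * diameter G (component v) + 5

    -- After `i` successful rounds, `C` holds the vertices reachable from `v` that reach `v` within
    -- `i` edges. Another success exhibits a vertex of the component at distance exactly `suc i` to
    -- `v`, so `suc i` is still at most the diameter. Fuel is measured as in the forward search.
    backward-correct : ∀ fuel {i FW C} → IsForward U v FW → ∣ U ∣ < fuel + ∣ C ∣ →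
                       i ≤ diameter G (component v) →
                       (∀ {x} → x ∈ C ⇔ (Reach G v x × ∃[ k ] (k ≤ i × Path G k x v))) →
                       Every (BackwardResult i) (backward G fuel U FW C)
    backward-correct zero {C = C} isFW enough _ cc =
      contradiction (p⊆q⇒∣p∣≤∣q∣ λ x∈ → let r , k , _ , p = to cc x∈ in convex v∈U v∈U r (k , p)) (<⇒≱ enough)
    backward-correct (suc fuel) {i} {FW} {C} isFW enough i≤D cc = Every-ifEmpty N exhausted continue
      where
      B = (PreSet G C ∩ U) ∩ FW
      N = B ─ C
      C′ = C ∪ B

      ∈B : ∀ {x} → x ∈ B ⇔ (Reach G v x × ∃[ k ] (k ≤ i × Path G (suc k) x v))
      ∈B = mk⇔ sound complete
        where
        sound : ∀ {x} → x ∈ B → Reach G v x × ∃[ k ] (k ≤ i × Path G (suc k) x v)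
        sound x∈
          with x∈P , x∈FW ← x∈p∩q⁻ (PreSet G C ∩ U) FW x∈
          with s , s∈C , e ← to ∈-PreSet (proj₁ (x∈p∩q⁻ (PreSet G C) U x∈P))
          with _ , k , k≤i , p ← to cc s∈C = proj₂ (to isFW x∈FW) , k , k≤i , e ∷ p
        complete : ∀ {x} → Reach G v x × ∃[ k ] (k ≤ i × Path G (suc k) x v) → x ∈ B
        complete (r , k , k≤i , e ∷ p) =
          x∈p∩q⁺ (x∈p∩q⁺ (from ∈-PreSet (_ , from cc (reach-trans r (edge-reach e) , k , k≤i , p) , e) , x∈U)
                 , from isFW (x∈U , r))
          where x∈U = convex v∈U v∈U r (_ , e ∷ p)

      exhausted : Empty N → BackwardResult i C 5
      exhausted N≡∅ = ⊆-antisym (λ x∈ → let r , k , _ , p = to cc x∈ in from ∈-component (r , k , p))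
                                (λ x∈ → let r , k , p = to ∈-component x∈ in arrived k r p)
                    , ≤-trans (+-monoʳ-≤ 5 (*-monoʳ-≤ 9 i≤D)) (≤-reflexive (+-comm 5 _))
        where
        arrived : ∀ k {x} → Reach G v x → Path G k x v → x ∈ C
        arrived zero r [] = from cc (r , 0 , z≤n , [])
        arrived (suc k) {x} r (e ∷ p) with x ∈? C
        ... | yes x∈C = x∈C
        ... | no  x∉C
          with _ , j , j≤i , q ← to cc (arrived k (reach-trans r (edge-reach e)) p) =
          contradiction (x , x∈p∧x∉q⇒x∈p─q (from ∈B (r , j , j≤i , e ∷ q)) x∉C) N≡∅

      cc′ : ∀ {x} → x ∈ C′ ⇔ (Reach G v x × ∃[ k ] (k ≤ suc i × Path G k x v))
      cc′ = mk⇔ sound complete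
        where
        sound : ∀ {x} → x ∈ C′ → Reach G v x × ∃[ k ] (k ≤ suc i × Path G k x v)
        sound x∈ with x∈p∪q⁻ C B x∈
        ... | inj₁ x∈C with r , k , k≤i , p ← to cc x∈C = r , k , m≤n⇒m≤1+n k≤i , p
        ... | inj₂ x∈B with r , k , k≤i , p ← to ∈B x∈B = r , suc k , s≤s k≤i , p
        complete : ∀ {x} → Reach G v x × ∃[ k ] (k ≤ suc i × Path G k x v) → x ∈ C′
        complete (r , zero  , _   , p) = x∈p∪q⁺ (inj₁ (from cc (r , 0 , z≤n , p)))
        complete (r , suc k , k≤i , p) = x∈p∪q⁺ (inj₂ (from ∈B (r , k , s≤s⁻¹ k≤i , p)))

      continue : Nonempty N → _
      continue (x , x∈N)
        with x∈B , x∉C ← ∈-─⁻ B C x∈N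
        with r , k , k≤i , p ← to ∈B x∈B =
        Every-map (backward G fuel U FW C′) charge
          (backward-correct fuel isFW enough′
            (distance≤diameter (from ∈-component (r , suc k , p)) v∈component far) cc′)
        where
        minimal : ∀ j → Path G j x v → suc i ≤ j
        minimal j q = ≰⇒> λ j≤i → x∉C (from cc (r , j , j≤i , q))
        far : Distance (suc i) x v
        far = subst (λ j → Path G (suc j) x v) (≤-antisym k≤i (s≤s⁻¹ (minimal _ p))) p , minimal
        enough′ : ∣ U ∣ < fuel + ∣ C′ ∣
        enough′ = begin-strict
          ∣ U ∣             <⟨ enough ⟩
          suc fuel + ∣ C ∣  ≡⟨ +-suc fuel ∣ C ∣ ⟨
          fuel + suc ∣ C ∣  ≤⟨ +-monoʳ-≤ fuel (∣p∣<∣p∪q∣ C B x∈B x∉C) ⟩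
          fuel + ∣ C′ ∣     ∎
          where open ≤-Reasoning
        shift : ∀ k i → k + 9 * suc i ≡ 9 + k + 9 * i
        shift = solve-∀
        -- A successful round takes five operations up to the emptiness test and four after it.
        charge : ∀ {C k} → BackwardResult (suc i) C k → BackwardResult i C (9 + k)
        charge {k = k} (C≡ , cost) = C≡ , subst (_≤ 9 * diameter G (component v) + 5) (shift k i) cost

  -- Skeletons and their restriction to the two subgraphs.

  data Skeleton (U S : Subset n) : Maybe (Fin n) → ℕ → Set where
    empty : ∀ {v?} → Empty S → Skeleton U S v? 0
    path  : ∀ {k s v} → S ⊆ U → Distance k s v → (p : Path G k s v) → IsVertexSet S p →
            Skeleton U S (just v) (suc k)

  -- A shorter replacement of a piece would shorten the whole path; `suc b` counts the cut edge with
  -- the second piece.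
  distance-prefix : ∀ {a b k s w t v} → k ≡ a + suc b → (∀ j → Path G j s v → k ≤ j) →
                    Path G a s w → w ⟶ t → Path G b t v → Distance a s w
  distance-prefix {b = b} refl minimal q e r = q , λ j q′ → +-cancelʳ-≤ (suc b) _ j (minimal _ (q′ ◅◅ e ∷ r))

  distance-suffix : ∀ {a b k s w t v} → k ≡ a + suc b → (∀ j → Path G j s v → k ≤ j) →
                    Path G a s w → w ⟶ t → Path G b t v → Distance b t v
  distance-suffix {a = a} refl minimal q e r = r , λ j r′ → s≤s⁻¹ (+-cancelˡ-≤ a _ _ (minimal _ (q ◅◅ e ∷ r′)))

  module Step {U : Subset n} (convex : Convex U) {v : Fin n} (v∈U : v ∈ U)
              {FW : Subset n} (isFW : IsForward U v FW) where

    private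
      C = component v
      D = diameter G C

    v∈FW : v ∈ FW
    v∈FW = from isFW (v∈U , reach-refl)

    FW⊆U : FW ⊆ U
    FW⊆U x∈ = proj₁ (to isFW x∈)

    FW∩→v⊆C : ∀ {x} → x ∈ FW → Reach G x v → x ∈ C
    FW∩→v⊆C x∈FW x→v = from ∈-component (proj₂ (to isFW x∈FW) , x→v)

    -- A vertex of `FW` on the way would bring the end of the path into `FW`.
    unreached-convex : Convex (U ─ FW)
    unreached-convex x∈ y∈ x→z z→y
      with x∈U , _ ← ∈-─⁻ U FW x∈ | y∈U , y∉FW ← ∈-─⁻ U FW y∈ =
      x∈p∧x∉q⇒x∈p─q (convex x∈U y∈U x→z z→y) λ z∈FW →
        y∉FW (from isFW (y∈U , reach-trans (proj₂ (to isFW z∈FW)) z→y))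

    -- A vertex of `C` on the way would bring the start of the path, which `v` reaches, into `C`.
    reached-convex : Convex (FW ─ C)
    reached-convex x∈ y∈ x→z z→y
      with x∈FW , x∉C ← ∈-─⁻ FW C x∈ | y∈FW , _ ← ∈-─⁻ FW C y∈
      with x∈U , v→x ← to isFW x∈FW =
      x∈p∧x∉q⇒x∈p─q (from isFW (convex x∈U (FW⊆U y∈FW) x→z z→y , reach-trans v→x x→z)) λ z∈C →
        x∉C (FW∩→v⊆C x∈FW (reach-trans x→z (proj₂ (to ∈-component z∈C))))

    ∣unreached∣<∣U∣ : ∣ U ─ FW ∣ < ∣ U ∣
    ∣unreached∣<∣U∣ = p⊂q⇒∣p∣<∣q∣ (p─q⊆p U FW , v , v∈U , λ v∈ → x∈p─q⇒x∉q U FW v∈ v∈FW)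

    ∣reached∣<∣U∣ : ∣ FW ─ C ∣ < ∣ U ∣
    ∣reached∣<∣U∣ = p⊂q⇒∣p∣<∣q∣
      ((λ x∈ → FW⊆U (p─q⊆p FW C x∈)) , v , v∈U , λ v∈ → x∈p─q⇒x∉q FW C v∈ v∈component)

    -- Convexity of `C` prevents the path from returning once it has left. The piece in `C` is a
    -- shortest path with at most `suc D` vertices; the rest, with `m` vertices, is the skeleton
    -- passed on.
    reached-skeleton : ∀ {l v′ S′} → v′ ∈ U → Distance l v v′ → (p : Path G l v v′) → IsVertexSet S′ p →
                       ∃[ m ] (Skeleton (FW ─ C) (S′ ─ C) (just v′) m × suc l ≤ suc D + m)
    reached-skeleton {l} {v′} {S′} v′∈U d@(_ , minimal) p isVS with v′ ∈? C
    ... | yes v′∈C = 0 , empty none , ≤-trans (s≤s (distance≤diameter v∈component v′∈C d)) (m≤m+n _ 0)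
      where
      none : Empty (S′ ─ C)
      none (x , x∈) with x∈S′ , x∉C ← ∈-─⁻ S′ C x∈ =
        x∉C (component-convex v∈component v′∈C (on-reachˡ (to isVS x∈S′)) (on-reachʳ (to isVS x∈S′)))
    ... | no v′∉C with cross (_∈? C) p v∈component v′∉C
    ... | crossing {a} {b} {w} {t} q e r refl on⁻ on⁺ˡ on⁺ʳ all t∉C =
      suc b , path ⊆FW─C (distance-suffix refl minimal q e r) r vertices ,
      s≤s (+-monoˡ-≤ (suc b) (distance≤diameter v∈component w∈C (distance-prefix refl minimal q e r)))
      where
      w∈C : w ∈ C
      w∈C = all (on-end q)
      ⊆FW─C : S′ ─ C ⊆ FW ─ C
      ⊆FW─C x∈ with x∈S′ , x∉C ← ∈-─⁻ S′ C x∈ =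
        x∈p∧x∉q⇒x∈p─q (from isFW (convex v∈U v′∈U v→x (on-reachʳ (to isVS x∈S′)) , v→x)) x∉C
        where v→x = on-reachˡ (to isVS x∈S′)
      vertices : IsVertexSet (S′ ─ C) r
      vertices = mk⇔ sound complete
        where
        sound : ∀ {x} → x ∈ S′ ─ C → On x r
        sound x∈ with x∈S′ , x∉C ← ∈-─⁻ S′ C x∈ with on⁻ (to isVS x∈S′)
        ... | inj₁ o = contradiction (all o) x∉C
        ... | inj₂ o = o
        complete : ∀ {x} → On x r → x ∈ S′ ─ C
        complete o = x∈p∧x∉q⇒x∈p─q (from isVS (on⁺ʳ o)) λ x∈C →
          t∉C (component-convex w∈C x∈C (edge-reach e) (on-reachˡ o))

    UnreachedSkeleton : Subset n → ℕ → Maybe (Fin n) → Set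
    UnreachedSkeleton S m w? = ∃[ m₁ ] (Skeleton (U ─ FW) (S ─ C) w? m₁ × m ≤ suc D + m₁)

    -- The mirror image: the old skeleton ends in `C` and stays there once it has entered. If it
    -- starts outside `C`, then `W` contains exactly the last vertex before the entry; otherwise
    -- `S ─ C` is empty, whatever is picked.
    unreached-skeleton : ∀ {S m} → Skeleton U S (just v) m →
      let W = ((PreSet G (C ∩ S) ∩ U) ─ C) ∩ S in
      (Empty W → UnreachedSkeleton S m nothing) × (∀ w → w ∈ W → UnreachedSkeleton S m (just w))
    unreached-skeleton {S} (empty S≡∅) = (λ _ → done) , λ _ _ → done
      where
      done : ∀ {w?} → UnreachedSkeleton S 0 w?
      done = 0 , empty (λ (x , x∈) → S≡∅ (x , p─q⊆p S C x∈)) , z≤n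
    unreached-skeleton {S} (path {k} {s} S⊆U d@(_ , minimal) p isVS) with s ∈? C
    ... | yes s∈C = (λ _ → done) , λ _ _ → done
      where
      none : Empty (S ─ C)
      none (x , x∈) with x∈S , x∉C ← ∈-─⁻ S C x∈ =
        x∉C (component-convex s∈C v∈component (on-reachˡ (to isVS x∈S)) (on-reachʳ (to isVS x∈S)))
      done : ∀ {w?} → UnreachedSkeleton S (suc k) w?
      done = 0 , empty none , ≤-trans (s≤s (distance≤diameter s∈C v∈component d)) (m≤m+n _ 0)
    -- With the complement of `C` as predicate, the cut is at the first edge entering `C`.
    ... | no s∉C with cross (λ x → ¬? (x ∈? C)) p s∉C (λ v∉C → v∉C v∈component)
    ... | crossing {a} {b} {w} {t} q e r refl on⁻ on⁺ˡ on⁺ʳ all ¬t∉C =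
      (λ W≡∅ → contradiction (w , w∈W) W≡∅) , λ x x∈W → subst (UnreachedSkeleton S _ ∘ just) (sym (only x∈W)) done
      where
      W = ((PreSet G (C ∩ S) ∩ U) ─ C) ∩ S
      t∈C : t ∈ C
      t∈C = decidable-stable (t ∈? C) ¬t∉C
      w∈S : w ∈ S
      w∈S = from isVS (on⁺ˡ (on-end q))
      w∈W : w ∈ W
      w∈W = x∈p∩q⁺ (x∈p∧x∉q⇒x∈p─q
        (x∈p∩q⁺ (from ∈-PreSet (t , x∈p∩q⁺ (t∈C , from isVS (on⁺ʳ start)) , e) , S⊆U w∈S)) (all (on-end q)) , w∈S)
      split : ∀ {x} → x ∈ S → x ∉ C → On x q
      split x∈S x∉C with on⁻ (to isVS x∈S)
      ... | inj₁ o = o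
      ... | inj₂ o = contradiction (component-convex t∈C v∈component (on-reachˡ o) (on-reachʳ o)) x∉C
      -- An edge from an earlier vertex of the skeleton into the component would be a shortcut.
      only : ∀ {x} → x ∈ W → x ≡ w
      only {x} x∈W
        with x∈N , x∈S ← x∈p∩q⁻ ((PreSet G (C ∩ S) ∩ U) ─ C) S x∈W
        with x∈P , x∉C ← ∈-─⁻ (PreSet G (C ∩ S) ∩ U) C x∈N
        with y , y∈ , f ← to ∈-PreSet (proj₁ (x∈p∩q⁻ (PreSet G (C ∩ S)) U x∈P))
        with y∈C , y∈S ← x∈p∩q⁻ C S y∈
        with prefix (split x∈S x∉C) | on⁻ (to isVS y∈S)
      ... | inj₁ x≡w | _ = x≡w
      ... | _ | inj₁ o = contradiction y∈C (all o)
      ... | inj₂ (i , i<a , q′) | inj₂ o with j , j≤b , r′ ← suffix-≤ o =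
        contradiction (minimal _ (q′ ◅◅ f ∷ r′)) (<⇒≱ (+-mono-<-≤ i<a (s≤s j≤b)))
      vertices : IsVertexSet (S ─ C) q
      vertices = mk⇔ (λ x∈ → let x∈S , x∉C = ∈-─⁻ S C x∈ in split x∈S x∉C)
                     (λ o → x∈p∧x∉q⇒x∈p─q (from isVS (on⁺ˡ o)) (all o))
      ⊆U─FW : S ─ C ⊆ U ─ FW
      ⊆U─FW x∈ with x∈S , x∉C ← ∈-─⁻ S C x∈ =
        x∈p∧x∉q⇒x∈p─q (S⊆U x∈S) λ x∈FW → x∉C (FW∩→v⊆C x∈FW (on-reachʳ (to isVS x∈S)))
      done : UnreachedSkeleton S (suc (a + suc b)) (just w)
      done = suc a , path ⊆U─FW (distance-prefix refl minimal q e r) q vertices , (begin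
        suc (a + suc b)  ≡⟨ +-comm (suc a) (suc b) ⟩
        suc b + suc a    ≤⟨ +-monoˡ-≤ (suc a) (s≤s (distance≤diameter t∈C v∈component
                              (distance-suffix refl minimal q e r))) ⟩
        suc D + suc a    ∎)
        where open ≤-Reasoning

  -- Outputs, their weight and their recombination.

  IsOutput : Subset n → List (Subset n) → Set
  IsOutput U os = Unique os × (∀ {C} → C List.∈ os ⇔ (IsSCC G C × C ⊆ U))

  weight : List (Subset n) → ℕ
  weight os = length os + sum (map (diameter G) os)

  weight-∷-++ : ∀ C os₁ os₂ → weight (C ∷ os₁ ++ os₂) ≡ suc (diameter G C) + (weight os₁ + weight os₂)
  weight-∷-++ C os₁ os₂
    rewrite length-++ os₁ {os₂} | map-++ (diameter G) os₁ os₂ | sum-++ (map (diameter G) os₁) (map (diameter G) os₂) =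
    rearrange (length os₁) (length os₂) (diameter G C) (sum (map (diameter G) os₁)) (sum (map (diameter G) os₂))
    where
    rearrange : ∀ a b d x y → suc (a + b) + (d + (x + y)) ≡ suc d + ((a + x) + (b + y))
    rearrange = solve-∀

  isOutput-empty : ∀ {U} → Empty U → IsOutput U []
  isOutput-empty U≡∅ = [] , mk⇔ (λ ()) λ { (((x , x∈C) , _) , C⊆U) → contradiction (x , C⊆U x∈C) U≡∅ }

  module _ {U : Subset n} (convex : Convex U) {v : Fin n} (v∈U : v ∈ U)
           {FW : Subset n} (isFW : IsForward U v FW) where
    open Step convex v∈U isFW

    -- `C`, `U ─ FW` and `FW ─ C` partition `U` and the last two are convex, so any vertex of an SCC
    -- decides which of the three contains it.
    isOutput-∷-++ : ∀ {os₁ os₂} → IsOutput (U ─ FW) os₁ → IsOutput (FW ─ component v) os₂ →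
                    IsOutput U (component v ∷ os₁ ++ os₂)
    isOutput-∷-++ {os₁} {os₂} (unique₁ , out₁) (unique₂ , out₂) =
      All.tabulate (λ { x∈ refl → fresh x∈ }) ∷ Unique.++⁺ unique₁ unique₂ disjoint , mk⇔ sound complete
      where
      C = component v

      fresh : ¬ C List.∈ os₁ ++ os₂
      fresh C∈ with ∈-++⁻ os₁ C∈
      ... | inj₁ C∈₁ = x∈p─q⇒x∉q U FW (proj₂ (to out₁ C∈₁) v∈component) v∈FW
      ... | inj₂ C∈₂ = x∈p─q⇒x∉q FW C (proj₂ (to out₂ C∈₂) v∈component) v∈component

      disjoint : ∀ {C′} → ¬ (C′ List.∈ os₁ × C′ List.∈ os₂)
      disjoint (C′∈₁ , C′∈₂) with ((x , x∈) , _) , ⊆₁ ← to out₁ C′∈₁ | _ , ⊆₂ ← to out₂ C′∈₂ =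
        x∈p─q⇒x∉q U FW (⊆₁ x∈) (p─q⊆p FW C (⊆₂ x∈))

      sound : ∀ {C′} → C′ List.∈ C ∷ os₁ ++ os₂ → IsSCC G C′ × C′ ⊆ U
      sound (here refl) = component-isSCC , component⊆ convex v∈U
      sound (there C′∈) with ∈-++⁻ os₁ C′∈
      ... | inj₁ C′∈₁ with scc , ⊆₁ ← to out₁ C′∈₁ = scc , λ x∈ → p─q⊆p U FW (⊆₁ x∈)
      ... | inj₂ C′∈₂ with scc , ⊆₂ ← to out₂ C′∈₂ = scc , λ x∈ → FW⊆U (p─q⊆p FW C (⊆₂ x∈))

      complete : ∀ {C′} → IsSCC G C′ × C′ ⊆ U → C′ List.∈ C ∷ os₁ ++ os₂
      complete (scc@((u , u∈) , _) , C′⊆U) with refl ← isSCC⇒component scc u∈ with u ∈? C | u ∈? FW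
      ... | yes u∈C | _ = here (sym (isSCC⇒component component-isSCC u∈C))
      ... | no u∉C | yes u∈FW = there (∈-++⁺ʳ os₁ (from out₂ (scc ,
              component⊆ reached-convex (x∈p∧x∉q⇒x∈p─q u∈FW u∉C))))
      ... | no _ | no u∉FW = there (∈-++⁺ˡ (from out₁ (scc ,
              component⊆ unreached-convex (x∈p∧x∉q⇒x∈p─q (C′⊆U u∈) u∉FW))))

  -- Correctness and cost of the recursion.

  PickIfAny-correct : ∀ {P : Maybe (Fin n) → Set} S → (Empty S → P nothing) → (∀ x → x ∈ S → P (just x)) →
                      Every (λ w? k → P w? × k ≤ 2) (PickIfAny S)
  PickIfAny-correct S none some = Every-ifEmpty S
    (λ S≡∅ → none S≡∅ , s≤s z≤n)
    (λ S≢∅ → S≢∅ , λ x x∈S → some x x∈S , ≤-refl)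

  -- A vertex picked for the skeleton is paid for when the component containing it is output, so that
  -- a skeleton with m vertices amounts to a debt of 10 m.
  FindResult : Subset n → ℕ → List (Subset n) → ℕ → Set
  FindResult U m os k = IsOutput U os × k + 10 * m ≤ 40 * weight os + 1

  -- The literals 2, 5, 2, 2 on the left are the single operations between the calls of the procedures.
  find-cost : ∀ k₁ k₂ k₃ k₄ k₅ k₆ m D w₁ w₂ {l m₁ m₂} →
              k₁ ≤ 1 → k₂ ≤ 10 * suc l → k₃ + 9 * 0 ≤ 9 * D + 5 → k₄ ≤ 2 →
              k₅ + 10 * m₁ ≤ 40 * w₁ + 1 → k₆ + 10 * m₂ ≤ 40 * w₂ + 1 →
              m ≤ suc D + m₁ → suc l ≤ suc D + m₂ →
              2 + (k₁ + (k₂ + (k₃ + (5 + (k₄ + (2 + (k₅ + (2 + (k₆ + 0))))))))) + 10 * m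
                ≤ 40 * (suc D + (w₁ + w₂)) + 1
  find-cost k₁ k₂ k₃ k₄ k₅ k₆ m D w₁ w₂ {l} {m₁} {m₂} k₁≤ k₂≤ k₃≤ k₄≤ k₅≤ k₆≤ m≤ l≤ = begin
    2 + (k₁ + (k₂ + (k₃ + (5 + (k₄ + (2 + (k₅ + (2 + (k₆ + 0))))))))) + 10 * m
      ≡⟨ eq₁ k₁ k₂ k₃ k₄ k₅ k₆ (10 * m) ⟩
    11 + k₁ + k₄ + (k₃ + 9 * 0) + (k₂ + 10 * m) + (k₅ + k₆)
      ≤⟨ +-monoˡ-≤ (k₅ + k₆) (+-mono-≤ (+-mono-≤ (+-mono-≤ (+-monoʳ-≤ 11 k₁≤) k₄≤) k₃≤)
           (+-mono-≤ (≤-trans k₂≤ (*-monoʳ-≤ 10 l≤)) (*-monoʳ-≤ 10 m≤))) ⟩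
    11 + 1 + 2 + (9 * D + 5) + (10 * (suc D + m₂) + 10 * (suc D + m₁)) + (k₅ + k₆)
      -- The terms `10 * m₁` and `10 * m₂` are the debts of the recursive calls. The constants sum
      -- to 39; with 1 from each call they give 40 for the new component and the final 1. The factor
      -- 9 + 20 of `D` is rounded up to 40.
      ≡⟨ eq₂ D m₁ m₂ k₅ k₆ ⟩
    39 + 29 * D + ((k₅ + 10 * m₁) + (k₆ + 10 * m₂))
      ≤⟨ +-mono-≤ (+-monoʳ-≤ 39 (*-monoˡ-≤ D (m≤m+n 29 11))) (+-mono-≤ k₅≤ k₆≤) ⟩
    39 + 40 * D + ((40 * w₁ + 1) + (40 * w₂ + 1))
      ≡⟨ eq₃ D w₁ w₂ ⟩
    40 * (suc D + (w₁ + w₂)) + 1 ∎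
    where
    open ≤-Reasoning
    eq₁ : ∀ k₁ k₂ k₃ k₄ k₅ k₆ x →
          2 + (k₁ + (k₂ + (k₃ + (5 + (k₄ + (2 + (k₅ + (2 + (k₆ + 0))))))))) + x
            ≡ 11 + k₁ + k₄ + (k₃ + 9 * 0) + (k₂ + x) + (k₅ + k₆)
    eq₁ = solve-∀
    eq₂ : ∀ D m₁ m₂ k₅ k₆ →
          11 + 1 + 2 + (9 * D + 5) + (10 * (suc D + m₂) + 10 * (suc D + m₁)) + (k₅ + k₆)
            ≡ 39 + 29 * D + ((k₅ + 10 * m₁) + (k₆ + 10 * m₂))
    eq₂ = solve-∀
    eq₃ : ∀ D w₁ w₂ → 39 + 40 * D + ((40 * w₁ + 1) + (40 * w₂ + 1)) ≡ 40 * (suc D + (w₁ + w₂)) + 1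
    eq₃ = solve-∀

  -- After one unit for the call itself, more than `∣ U ∣` units remain for its loops. Both
  -- recursive calls are on sets without `v`, hence smaller than `U`, and so inherit the fuel
  -- hypothesis.
  sccFind-correct : ∀ fuel {U S v? m} → Convex U → suc ∣ U ∣ < fuel → Skeleton U S v? m →
                    Every (FindResult U m) (sccFind G fuel U (S , v?))
  sccFind-correct (suc fuel) {U} {S} {v?} {m} convex (s<s enough) skel = Every-ifEmpty U (finished skel) λ U≢∅ →
    Every->>= {P = StartResult} (if not (does (nonempty? S)) then Pick U else fromJust v?)
      (Every-ifEmpty S (pickAny skel U≢∅) (resume skel)) λ where
      v k₁ (v∈U , skel , k₁≤) →
        let open Search convex v∈U
            C = component v in
        Every->>= {P = SkelForwardResult} (skelForward G fuel U v) (skelForward-correct enough) λ where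
        (FW , S′ , v′) k₂ (isFW , l , v′∈U , d , (p , isVS) , k₂≤) →
          let open Step convex v∈U isFW
              W = ((PreSet G (C ∩ S) ∩ U) ─ C) ∩ S
              none , some = unreached-skeleton skel
              m₂ , skel₂ , l≤ = reached-skeleton v′∈U d p isVS in
          Every->>= {P = BackwardResult 0} (backward G fuel U FW ⁅ v ⁆)
            (backward-correct fuel isFW (single v) z≤n start-set) λ where
          _ k₃ (refl , k₃≤) →
            Every->>= {P = λ w? k → UnreachedSkeleton S m w? × k ≤ 2}
                      {Q = λ os k → FindResult U m os (2 + (k₁ + (k₂ + (k₃ + (5 + k)))))} (PickIfAny W)
              (PickIfAny-correct W none some) λ where
            w? k₄ ((m₁ , skel₁ , m≤) , k₄≤) →
              Every->>= {P = FindResult (U ─ FW) m₁} (sccFind G fuel (U ─ FW) (S ─ C , w?))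
                (sccFind-correct fuel unreached-convex (≤-trans (s<s ∣unreached∣<∣U∣) enough) skel₁) λ where
              os₁ k₅ (out₁ , k₅≤) →
                Every->>= {P = FindResult (FW ─ C) m₂} (sccFind G fuel (FW ─ C) (S′ ─ C , just v′))
                  (sccFind-correct fuel reached-convex (≤-trans (s<s ∣reached∣<∣U∣) enough) skel₂) λ where
                os₂ k₆ (out₂ , k₆≤) →
                  isOutput-∷-++ convex v∈U isFW out₁ out₂ ,
                  subst (λ w → 2 + (k₁ + (k₂ + (k₃ + (5 + (k₄ + (2 + (k₅ + (2 + (k₆ + 0))))))))) + 10 * m ≤ 40 * w + 1)
                    (sym (weight-∷-++ C os₁ os₂))
                    (find-cost k₁ k₂ k₃ k₄ k₅ k₆ m (diameter G C) (weight os₁) (weight os₂)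
                      k₁≤ k₂≤ k₃≤ k₄≤ k₅≤ k₆≤ m≤ l≤)
    where
    finished : Skeleton U S v? m → Empty U → FindResult U m [] 1
    finished (empty _)           U≡∅ = isOutput-empty U≡∅ , ≤-refl
    finished (path S⊆U _ _ isVS) U≡∅ = contradiction (_ , S⊆U (from isVS start)) U≡∅

    StartResult : Fin n → ℕ → Set
    StartResult v k = v ∈ U × Skeleton U S (just v) m × k ≤ 1

    pickAny : Skeleton U S v? m → Nonempty U → Empty S → Every StartResult (Pick U)
    pickAny (empty _)         U≢∅ S≡∅ = U≢∅ , λ v v∈U → v∈U , empty S≡∅ , ≤-refl
    pickAny (path _ _ _ isVS) _   S≡∅ = contradiction (_ , from isVS start) S≡∅

    resume : Skeleton U S v? m → Nonempty S → Every StartResult (fromJust v?)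
    resume (empty S≡∅)            S≢∅ = contradiction S≢∅ S≡∅
    resume sk@(path S⊆U _ p isVS) _   = S⊆U (from isVS (on-end p)) , sk , z≤n

    single : ∀ v → ∣ U ∣ < fuel + ∣ ⁅ v ⁆ ∣
    single v = ≤-trans enough (m≤m+n fuel _)

    start-set : ∀ {v x} → x ∈ ⁅ v ⁆ ⇔ (Reach G v x × ∃[ k ] (k ≤ 0 × Path G k x v))
    start-set {v} = mk⇔ sound λ { (_ , _ , z≤n , []) → x∈⁅x⁆ v }
      where
      sound : ∀ {x} → x ∈ ⁅ v ⁆ → Reach G v x × ∃[ k ] (k ≤ 0 × Path G k x v)
      sound x∈ with refl ← x∈⁅y⁆⇒x≡y v x∈ = reach-refl , 0 , z≤n , []

  -- Comparison with the enumerated components and the final bound.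

  SCCs-isOutput : IsOutput ⊤ (SCCs G)
  SCCs-isOutput = Unique.filter⁺ (isSCC? G) (allSubsets-unique n) , mk⇔
    (λ C∈ → proj₂ (∈-filter⁻ (isSCC? G) {xs = allSubsets n} C∈) , λ {_} _ → ∈⊤)
    (λ (scc , _) → ∈-filter⁺ (isSCC? G) (∈-allSubsets _) scc)

  -- Without duplicates, having the same members is enough for a permutation.
  isOutput-↭ : ∀ {U os os′} → IsOutput U os → IsOutput U os′ → os ↭ os′
  isOutput-↭ (unique , out) (unique′ , out′) = ∼bag⇒↭ (unique∧set⇒bag unique unique′
    (mk⇔ (from out′ ∘ to out) (from out ∘ to out′)))

  weight-↭ : ∀ {os os′} → os ↭ os′ → weight os ≡ weight os′
  weight-↭ os↭os′ = cong₂ _+_ (↭-length os↭os′) (sum-↭ (map⁺ (diameter G) os↭os′))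

  weight-positive : ∀ {os C} → C List.∈ os → 1 ≤ weight os
  weight-positive {_ ∷ _} _ = s≤s z≤n

vertex : ∀ n → NonZero n → Fin n
vertex (suc n) _ = zero

theorem4p1 : ∃[ c ] (∀ (n : ℕ) (G : Digraph n) → ∃[ fuel ]
    Every (λ outputs cost →
    (outputs ↭ SCCs G)
    × (NonZero n → cost ≤ c * (length (SCCs G) + sum (map (diameter G) (SCCs G)))))
    (sccFind G fuel ⊤ (⊥ , nothing)))
-- `2 + n` exceeds `suc ∣ ⊤ ∣`, and the empty skeleton starts with debt 0.
theorem4p1 = 41 , λ n G → 2 + n ,
  Every-map {P = FindResult G ⊤ 0} (sccFind G (2 + n) ⊤ (⊥ , nothing)) (conclude G)
    (sccFind-correct G (2 + n) (λ _ _ _ _ → ∈⊤) (s<s (s≤s (∣p∣≤n {n} ⊤))) (empty λ (_ , x∈) → ∉⊥ x∈))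
  where
  conclude : ∀ {n} (G : Digraph n) {os k} → FindResult G ⊤ 0 os k →
             (os ↭ SCCs G) × (NonZero n → k ≤ 41 * weight G (SCCs G))
  conclude {n} G {os} {k} (out , k≤) = os↭ , λ n≢0 → begin
    k                                  ≡⟨ +-identityʳ k ⟨
    k + 0                              ≤⟨ k≤ ⟩
    -- A graph with a vertex has an SCC, so its weight is at least 1 and absorbs the additive 1,
    -- turning 40 into 41. On the empty graph the weight is 0, while the emptiness test costs 1.
    40 * weight G os + 1               ≤⟨ +-monoʳ-≤ (40 * weight G os) (weight-positive G
                                            (from (proj₂ out) (component-isSCC G {vertex n n≢0} , λ {_} _ → ∈⊤))) ⟩
    40 * weight G os + weight G os     ≡⟨ +-comm (40 * weight G os) (weight G os) ⟩
    41 * weight G os                   ≡⟨ cong (41 *_) (weight-↭ G os↭) ⟩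
    41 * weight G (SCCs G)             ∎
    where
    open ≤-Reasoning
    os↭ : os ↭ SCCs G
    os↭ = isOutput-↭ G out (SCCs-isOutput G)
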